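{- Let $N \geq 2$ be an integer, and let $C = \{c_1 < c_2 < \cdots < c_r\}$ and $C^* = \{c_1^* < c_2^* < \cdots < c_s^*\}$ be two sorted change-point sets, i.e. (possibly empty) subsets of $\{1,\ldots,N-1\}$ of sizes $r$ and $s$ respectively. Define $c_0 = c_0^* = 0$ and $c_{r+1} = c_{s+1}^* = N$. Identify $C$ with the clustering $\{\{c_i+1,\ldots,c_{i+1}\} : 0 \le i \le r\}$ of $\{1,\ldots,N\}$ and $C^*$ with the clustering $\{\{c_j^*+1,\ldots,c_{j+1}^*\} : 0 \le j \le s\}$ of $\{1,\ldots,N\}$. Then the Rand Index $RI$ between these two clusterings is given by $$RI = 1 - \frac{\sum_{i=0}^{r}\sum_{j=0}^{s} n_{ij}\,|c_{i+1} - c_{j+1}^*|}{\binom{N}{2}},$$ where $$n_{ij} = \max\left(0,\ \min\left(c_{i+1},c_{j+1}^*\right) - \max\left(c_{i},c_{j}^*\right)\right).$$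
   Context: A clustering of $\{1,\ldots,N\}$ is a partition of $\{1,\ldots,N\}$ into nonempty sets, called clusters. For a clustering $P$ and $i,j\in\{1,\ldots,N\}$, let $I_P(i,j) = 1$ if $i$ and $j$ belong to the same cluster of $P$ and $I_P(i,j)=0$ otherwise. Given two clusterings $P_1,P_2$ of $\{1,\ldots,N\}$, define $$N_{11} = |\{(i,j)\in\{1,\ldots,N\}^2 : i<j,\ I_{P_1}(i,j) = 1 = I_{P_2}(i,j)\}|,$$ $$N_{00} = |\{(i,j)\in\{1,\ldots,N\}^2 : i<j,\ I_{P_1}(i,j) = 0 = I_{P_2}(i,j)\}|.$$ The Rand Index between $P_1$ and $P_2$ is $RI = \dfrac{N_{00}+N_{11}}{\binom{N}{2}}$. -}

module Defs where

open import Data.Bool.Base using (if_then_else_)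
open import Data.Bool.Properties using (T-≡)
open import Data.Fin.Base as Fin using (Fin; zero; suc; toℕ; fromℕ<; inject₁)
open import Data.Fin.Properties as Fin using (toℕ-fromℕ<; toℕ<n; toℕ-inject₁; any?)
open import Data.Fin.Subset using (Subset; _∈_; Nonempty)
open import Data.Fin.Subset.Properties using (_∈?_)
open import Data.Integer.Base using (+_)
open import Data.List.Base using (List; length; filter; allFin; cartesianProduct)
open import Data.Nat.Base
open import Data.Nat.Combinatorics using (nCk≡n!/k![n-k]!; k![n∸k]!∣n!) renaming (_C_ to _choose_)
open import Data.Nat.DivMod using (m≥n⇒m/n>0)
open import Data.Nat.Divisibility using (∣⇒≤)
open import Data.Nat.Properties
open import Data.Product using (∃; _×_; _,_; proj₁; proj₂)
open import Data.Rational.Base as ℚ using (ℚ)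
open import Data.Sum.Base using (inj₁; inj₂)
open import Data.Vec.Base using (Vec; []; _∷_; _∷ʳ_; lookup; tabulate)
open import Data.Vec.Properties using (lookup∘tabulate; lookup⇒[]=; []=⇒lookup)
open import Data.Vec.Relation.Unary.All using (All; []; _∷_)
open import Data.Vec.Relation.Unary.Linked using (Linked; []; [-]; _∷_)
import Data.Vec.Relation.Unary.Linked.Properties as Linked
open import Function.Bundles using (Equivalence)
open import Relation.Binary.Definitions using (tri<; tri≈; tri>)
open import Relation.Binary.PropositionalEquality using (_≡_; refl; sym; trans; cong; subst)
open import Relation.Nullary using (¬_; Dec; does; yes; no; contradiction)
open import Relation.Nullary.Decidable using (_×-dec_; dec-true; toWitness; isYes≗does)

open import Algebra.Properties.CommutativeMonoid.Sum +-0-commutativeMonoid public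
  using (sum⁺-syntax)

-- The ground set {1,…,N} is represented by Fin N, with x : Fin N standing for
-- the integer suc (toℕ x).

-- Distinct indices give disjoint nonempty, hence distinct, clusters, so the
-- family `cluster` enumerates a set of clusters without repetition.
record Clustering (N : ℕ) : Set where
  field
    size     : ℕ
    cluster  : Fin size → Subset N
    nonempty : ∀ a → Nonempty (cluster a)
    disjoint : ∀ {a b x} → x ∈ cluster a → x ∈ cluster b → a ≡ b
    cover    : ∀ x → ∃ λ a → x ∈ cluster a

module _ {N : ℕ} where

  SameCluster : Clustering N → Fin N → Fin N → Set
  SameCluster P i j = ∃ λ a → i ∈ cluster a × j ∈ cluster a
    where open Clustering P

  sameCluster? : ∀ P i j → Dec (SameCluster P i j)
  sameCluster? P i j = any? λ a → (i ∈? cluster a) ×-dec (j ∈? cluster a)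
    where open Clustering P

  I : Clustering N → Fin N → Fin N → ℕ
  I P i j = if does (sameCluster? P i j) then 1 else 0

  -- The pairs i < j with I P₁ i j = v = I P₂ i j.
  agreeing : ℕ → Clustering N → Clustering N → List (Fin N × Fin N)
  agreeing v P₁ P₂ =
    filter (λ (i , j) → (i Fin.<? j) ×-dec ((I P₁ i j ≟ v) ×-dec (v ≟ I P₂ i j)))
           (cartesianProduct (allFin N) (allFin N))

  N₁₁ N₀₀ : Clustering N → Clustering N → ℕ
  N₁₁ P₁ P₂ = length (agreeing 1 P₁ P₂)
  N₀₀ P₁ P₂ = length (agreeing 0 P₁ P₂)

instance
  NC2-nonZero : ∀ {N} → .{{NonTrivial N}} → NonZero (N choose 2)
  NC2-nonZero {N} = >-nonZero (subst (0 <_) (sym (nCk≡n!/k![n-k]! 2≤N))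
    (m≥n⇒m/n>0 {{ne}} (∣⇒≤ {{N !≢0}} (k![n∸k]!∣n! 2≤N))))
    where
    2≤N = nonTrivial⇒n>1 N
    ne = 2 !* (N ∸ 2) !≢0

RI : ∀ {N} → .{{NonTrivial N}} → Clustering N → Clustering N → ℚ
RI {N} P₁ P₂ = + (N₀₀ P₁ P₂ + N₁₁ P₁ P₂) ℚ./ (N choose 2)

record ChangePoints (N r : ℕ) : Set where
  field
    points  : Vec ℕ r
    sorted  : Linked _<_ points
    inRange : All (λ c → 1 ≤ c × c < N) points

module _ {N r : ℕ} (C : ChangePoints N r) where
  open ChangePoints C

  -- c₀ = 0, c₁, …, c_r, c_{r+1} = N
  boundaries : Vec ℕ (2 + r)
  boundaries = 0 ∷ (points ∷ʳ N)

  -- For 0 ≤ i ≤ r: lower i = c_i and upper i = c_{i+1}.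
  lower upper : Fin (suc r) → ℕ
  lower i = lookup boundaries (inject₁ i)
  upper i = lookup boundaries (suc i)

  -- x lies in the block {c_i + 1, …, c_{i+1}}.
  inSegment? : ∀ i (x : Fin N) → Dec (lower i + 1 ≤ suc (toℕ x) × suc (toℕ x) ≤ upper i)
  inSegment? i x = (lower i + 1 ≤? suc (toℕ x)) ×-dec (suc (toℕ x) ≤? upper i)

  segment : Fin (suc r) → Subset N
  segment i = tabulate λ x → does (inSegment? i x)

-- n_{ij}; truncated subtraction m ∸ n is max(0, m − n).
overlapLength : ∀ {N r s} → ChangePoints N r → ChangePoints N s →
                Fin (suc r) → Fin (suc s) → ℕ
overlapLength C C* i j = (upper C i ⊓ upper C* j) ∸ (lower C i ⊔ lower C* j)

module _ {N r : ℕ} (C : ChangePoints N r) where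
  open ChangePoints C

  ∈-segment⁺ : ∀ {i x} → lower C i ≤ toℕ x → toℕ x < upper C i → x ∈ segment C i
  ∈-segment⁺ {i} {x} l u = lookup⇒[]= x _ (trans (lookup∘tabulate _ x)
    (dec-true (inSegment? C i x) (subst (_≤ suc (toℕ x)) (+-comm 1 (lower C i)) (s≤s l) , u)))

  ∈-segment⁻ : ∀ {i x} → x ∈ segment C i → lower C i ≤ toℕ x × toℕ x < upper C i
  ∈-segment⁻ {i} {x} x∈ = s≤s⁻¹ (subst (_≤ suc (toℕ x)) (+-comm (lower C i) 1) (proj₁ lu)) , proj₂ lu
    where
    lu = toWitness {a? = inSegment? C i x} (Equivalence.from T-≡
      (trans (sym (trans (lookup∘tabulate _ x) (sym (isYes≗does (inSegment? C i x)))))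
             ([]=⇒lookup x∈)))

  boundaries-sorted : 0 < N → Linked _<_ (boundaries C)
  boundaries-sorted 0<N = start sorted inRange
    where
    snoc : ∀ {k a} {v : Vec ℕ k} → a < N → Linked _<_ (a ∷ v) →
           All (λ c → 1 ≤ c × c < N) v → Linked _<_ (a ∷ (v ∷ʳ N))
    snoc a<N [-]         []              = a<N ∷ [-]
    snoc a<N (a<c ∷ cs) ((_ , c<N) ∷ v) = a<c ∷ snoc c<N cs v

    start : ∀ {k} {v : Vec ℕ k} → Linked _<_ v →
            All (λ c → 1 ≤ c × c < N) v → Linked _<_ (0 ∷ (v ∷ʳ N))
    start []             []              = snoc 0<N [-] []
    start cs@[-]         v@((0<c , _) ∷ _) = snoc 0<N (0<c ∷ cs) v
    start cs@(_ ∷ _)     v@((0<c , _) ∷ _) = snoc 0<N (0<c ∷ cs) v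

  lower<upper : 0 < N → ∀ i → lower C i < upper C i
  lower<upper 0<N i = Linked.lookup⁺ <-trans (boundaries-sorted 0<N)
    (s≤s (≤-reflexive (toℕ-inject₁ i)))

  upper≤lower : 0 < N → ∀ {i j} → i Fin.< j → upper C i ≤ lower C j
  upper≤lower 0<N {i} {j} i<j with m≤n⇒m<n∨m≡n i<j
  ... | inj₁ si<j = <⇒≤ (Linked.lookup⁺ <-trans (boundaries-sorted 0<N)
          (subst (suc (toℕ i) <_) (sym (toℕ-inject₁ j)) si<j))
  ... | inj₂ si≡j = ≤-reflexive (cong (lookup (boundaries C))
          (Fin.toℕ-injective (trans si≡j (sym (toℕ-inject₁ j)))))

  upper≤N : ∀ i → upper C i ≤ N
  upper≤N = go inRange
    where
    go : ∀ {k} {v : Vec ℕ k} → All (λ c → 1 ≤ c × c < N) v →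
         ∀ i → lookup (v ∷ʳ N) i ≤ N
    go []              zero    = ≤-refl
    go ((_ , c<N) ∷ v) zero    = <⇒≤ c<N
    go (_ ∷ v)         (suc i) = go v i

  locate : ∀ {x} → x < N → ∃ λ i → lower C i ≤ x × x < upper C i
  locate {x} x<N = go points z≤n
    where
    go : ∀ {k a} (v : Vec ℕ k) → a ≤ x → ∃ λ (i : Fin (suc k)) →
         lookup (a ∷ (v ∷ʳ N)) (inject₁ i) ≤ x × x < lookup (a ∷ (v ∷ʳ N)) (suc i)
    go []      a≤x = zero , a≤x , x<N
    go (c ∷ v) a≤x with x <? c
    ... | yes x<c = zero , a≤x , x<c
    ... | no  x≮c with go v (≮⇒≥ x≮c)
    ...   | i , p = suc i , p

  clustering : .{{NonTrivial N}} → Clustering N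
  clustering = record
    { size     = suc r
    ; cluster  = segment C
    ; nonempty = λ i → let l<N = <-≤-trans (lower<upper 0<N i) (upper≤N i) in
        fromℕ< l<N ,
        ∈-segment⁺ (≤-reflexive (sym (toℕ-fromℕ< l<N)))
                   (subst (_< upper C i) (sym (toℕ-fromℕ< l<N)) (lower<upper 0<N i))
    ; disjoint = disj
    ; cover    = λ x → let i , l , u = locate (toℕ<n x) in i , ∈-segment⁺ l u
    }
    where
    0<N : 0 < N
    0<N = <⇒≤ (nonTrivial⇒n>1 N)

    apart : ∀ {i j x} → i Fin.< j → x ∈ segment C i → ¬ x ∈ segment C j
    apart i<j x∈i x∈j = <⇒≱ (proj₂ (∈-segment⁻ x∈i))
      (≤-trans (upper≤lower 0<N i<j) (proj₁ (∈-segment⁻ x∈j)))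

    disj : ∀ {i j x} → x ∈ segment C i → x ∈ segment C j → i ≡ j
    disj {i} {j} x∈i x∈j with Fin.<-cmp i j
    ... | tri< i<j _ _ = contradiction x∈j (apart i<j x∈i)
    ... | tri≈ _ i≡j _ = i≡j
    ... | tri> _ _ j<i = contradiction x∈i (apart j<i x∈j)

{-# OPTIONS --safe #-}
module Submission where

-- Count the pairs x < y on which the two clusterings disagree by their smaller
-- element x.  If u and u* are the right ends of the blocks containing x, then
-- y > x lies in the block of x iff y ≤ u (resp. y ≤ u*), so x contributes
-- |u − u*| such pairs, and n_{ij} elements x have u = c_{i+1} and u* = c*_{j+1}.

open import Defs
import Algebra.Properties.Semiring.Sum as Sum
open import Data.Bool.Base using (true; false; if_then_else_)
open import Data.Fin.Base using (Fin; zero; suc; toℕ)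
open import Data.Fin.Properties using (toℕ<n; punchInᵢ≢i)
open import Data.Fin.Subset using (_∈_)
open import Data.Integer.Base as ℤ using (+_)
import Data.Integer.Properties as ℤ
open import Data.List.Base as List using (_++_; length; filter; map; cartesianProduct)
open import Data.List.Properties using (filter-++; length-++; map-tabulate)
open import Data.Nat.Base hiding (_/_)
open import Data.Nat.Combinatorics using (nCk+nC[k+1]≡[n+1]C[k+1]; nC1≡n) renaming (_C_ to _choose_)
open import Data.Nat.Properties
open import Data.Product.Base as Product using (_×_; _,_; proj₁; proj₂)
open import Data.Rational.Base as ℚ using (1ℚ; _-_; _/_; toℚᵘ)
import Data.Rational.Properties as ℚ
open import Data.Rational.Unnormalised.Base as ℚᵘ using (mkℚᵘ; *≡*)
import Data.Rational.Unnormalised.Properties as ℚᵘ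
open import Algebra.Properties.Group ℚ.+-0-group using (x≈z//y)
open import Function.Base using (_∘_; id)
open import Function.Bundles using (_⇔_; mk⇔)
open import Level using (Level)
open import Relation.Binary.PropositionalEquality
open import Relation.Nullary using (¬_; Dec; does; yes; no)
open import Relation.Nullary.Decidable using (_×-dec_; dec-true; dec-false; does-⇔)
open import Relation.Unary using (Pred; Decidable)

open Sum +-*-semiring using (sum; sum-syntax; sum-cong-≗; sum-replicate-zero; sum-remove; ∑-distrib-+; ∑-comm; *-distribʳ-sum)
open ≡-Reasoning

private
  variable
    a p : Level
    A B P Q : Set a
    m n u v x y : ℕ

-- Indicators and finite sums.

𝟙 : Dec P → ℕ
𝟙 P? = if does P? then 1 else 0

𝟙-true : (P? : Dec P) → P → 𝟙 P? ≡ 1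
𝟙-true P? p = cong (if_then 1 else 0) (dec-true P? p)

𝟙-false : (P? : Dec P) → ¬ P → 𝟙 P? ≡ 0
𝟙-false P? ¬p = cong (if_then 1 else 0) (dec-false P? ¬p)

𝟙-cong : P ⇔ Q → (P? : Dec P) (Q? : Dec Q) → 𝟙 P? ≡ 𝟙 Q?
𝟙-cong P⇔Q P? Q? = cong (if_then 1 else 0) (does-⇔ P⇔Q P? Q?)

between? : ∀ l u k → Dec (l ≤ k × k < u)
between? l u k = (l ≤? k) ×-dec (k <? u)

sum-zero : (f : Fin n → ℕ) → (∀ i → f i ≡ 0) → sum f ≡ 0
sum-zero {n} f f≡0 = trans (sum-cong-≗ f≡0) (sum-replicate-zero n)

sum-single : ∀ (f : Fin n → ℕ) i → (∀ j → j ≢ i → f j ≡ 0) → sum f ≡ f i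
sum-single {suc n} f i f≡0 = begin
  sum f    ≡⟨ sum-remove {i = i} f ⟩
  f i + _  ≡⟨ cong₂ _+_ refl (sum-zero _ λ j → f≡0 _ (punchInᵢ≢i i j)) ⟩
  f i + 0  ≡⟨ +-identityʳ (f i) ⟩
  f i      ∎

-- Induction on `u ≤ n`: dropping index 0 shifts the interval down by one, and index 0 itself counts
-- only when `l` is zero. For `l > u` the interval is empty and truncated subtraction agrees.
sum-between : ∀ l → u ≤ n → ∑[ x < n ] 𝟙 (between? l u (toℕ x)) ≡ u ∸ l
sum-between {n = n} l z≤n = trans
  (sum-zero {n} _ λ x → 𝟙-false (between? l 0 (toℕ x)) λ ()) (sym (0∸n≡0 l))
sum-between zero (s≤s u≤n) = cong suc (sum-between zero u≤n)
sum-between {suc u} {suc n} (suc l) (s≤s u≤n) = trans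
  (sum-cong-≗ {n} λ x → 𝟙-cong (mk⇔ (Product.map s≤s⁻¹ s≤s⁻¹) (Product.map s≤s s≤s))
    (between? (suc l) (suc u) (suc (toℕ x))) (between? l u (toℕ x)))
  (sum-between l u≤n)

-- Pascal's rule, with the summand at index 0 read as `n choose 1`.
sum-triangle : ∀ n → ∑[ x < n ] (n ∸ suc (toℕ x)) ≡ n choose 2
sum-triangle zero    = refl
sum-triangle (suc n) = begin
  n + ∑[ x < n ] (n ∸ suc (toℕ x))  ≡⟨ cong₂ _+_ (sym (nC1≡n n)) (sum-triangle n) ⟩
  n choose 1 + n choose 2           ≡⟨ nCk+nC[k+1]≡[n+1]C[k+1] n 1 ⟩
  suc n choose 2                    ∎

-- Lengths of filtered lists as sums of indicators.

length-filter-tabulate : {P : Pred A p} (P? : Decidable P) (f : Fin n → A) →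
  length (filter P? (List.tabulate f)) ≡ ∑[ i < n ] 𝟙 (P? (f i))
length-filter-tabulate {n = zero}  P? f = refl
length-filter-tabulate {n = suc n} P? f with does (P? (f zero))
... | true  = cong suc (length-filter-tabulate P? (f ∘ suc))
... | false = length-filter-tabulate P? (f ∘ suc)

-- Stated for tabulations of arbitrary `f` and `g`, so that the induction can pass to `f ∘ suc`;
-- `allFin` is the case `id`.
length-filter-cartesianProduct : {P : Pred (A × B) p} (P? : Decidable P) →
  (f : Fin m → A) (g : Fin n → B) →
  length (filter P? (cartesianProduct (List.tabulate f) (List.tabulate g)))
    ≡ ∑[ i < m ] ∑[ j < n ] 𝟙 (P? (f i , g j))
length-filter-cartesianProduct {m = zero}  P? f g = refl
length-filter-cartesianProduct {m = suc m} P? f g = begin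
  length (filter P? (row ++ rest))                   ≡⟨ cong length (filter-++ P? row rest) ⟩
  length (filter P? row ++ filter P? rest)           ≡⟨ length-++ (filter P? row) ⟩
  length (filter P? row) + length (filter P? rest)   ≡⟨ cong₂ _+_
    (trans (cong (length ∘ filter P?) (map-tabulate g (f zero ,_)))
           (length-filter-tabulate P? ((f zero ,_) ∘ g)))
    (length-filter-cartesianProduct P? (f ∘ suc) g) ⟩
  ∑[ j < _ ] 𝟙 (P? (f zero , g j)) + _               ∎
  where
  row  = map (f zero ,_) (List.tabulate g)
  rest = cartesianProduct (List.tabulate (f ∘ suc)) (List.tabulate g)

-- Agreement and disagreement on a single pair.

⊔∸⊓≡∣-∣ : ∀ m n → (m ⊔ n) ∸ (m ⊓ n) ≡ ∣ m - n ∣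
⊔∸⊓≡∣-∣ zero    n       = refl
⊔∸⊓≡∣-∣ (suc m) zero    = refl
⊔∸⊓≡∣-∣ (suc m) (suc n) = ⊔∸⊓≡∣-∣ m n

-- The shape copies the predicate filtered in `agreeing`; the values of `I` are abstracted so that
-- indicators can replace them.
agree? : ∀ w (x y α β : ℕ) → Dec (x < y × α ≡ w × w ≡ β)
agree? w x y α β = (x <? y) ×-dec ((α ≟ w) ×-dec (w ≟ β))

-- Think of `u` and `v` as the right ends of the blocks of `x`. For `y > x` exactly one case occurs:
-- `y` is below both ends, below neither, or below just one, and the last means `u ⊓ v ≤ y < u ⊔ v`.
-- For `y ≤ x` every term vanishes, because `x < u ⊓ v`.
agree+disagree : x < u → x < v → y < n →
  𝟙 (agree? 0 x y (𝟙 (y <? u)) (𝟙 (y <? v))) +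
  𝟙 (agree? 1 x y (𝟙 (y <? u)) (𝟙 (y <? v))) +
  𝟙 (between? (u ⊓ v) (u ⊔ v) y) ≡ 𝟙 (between? (suc x) n y)
agree+disagree {x} {u} {v} {y} {n} x<u x<v y<n with x <? y
... | no x≮y rewrite dec-false (x <? y) x≮y =
  𝟙-false (between? (u ⊓ v) (u ⊔ v) y) λ (u⊓v≤y , _) →
    x≮y (<-≤-trans (⊓-pres-m< x<u x<v) u⊓v≤y)
... | yes x<y rewrite dec-true (x <? y) x<y | dec-true (y <? n) y<n with y <? u | y <? v
...   | yes y<u | yes y<v rewrite dec-true (y <? u) y<u | dec-true (y <? v) y<v =
        cong suc (𝟙-false (between? (u ⊓ v) (u ⊔ v) y)
          λ (u⊓v≤y , _) → <⇒≱ (⊓-pres-m< y<u y<v) u⊓v≤y)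
...   | yes y<u | no  y≮v rewrite dec-true (y <? u) y<u | dec-false (y <? v) y≮v =
        𝟙-true (between? (u ⊓ v) (u ⊔ v) y)
          (≤-trans (m⊓n≤n u v) (≮⇒≥ y≮v) , <-≤-trans y<u (m≤m⊔n u v))
...   | no  y≮u | yes y<v rewrite dec-false (y <? u) y≮u | dec-true (y <? v) y<v =
        𝟙-true (between? (u ⊓ v) (u ⊔ v) y)
          (≤-trans (m⊓n≤m u v) (≮⇒≥ y≮u) , <-≤-trans y<v (m≤n⊔m u v))
...   | no  y≮u | no  y≮v rewrite dec-false (y <? u) y≮u | dec-false (y <? v) y≮v =
        cong suc (𝟙-false (between? (u ⊓ v) (u ⊔ v) y)
          λ (_ , y<u⊔v) → <⇒≱ y<u⊔v (⊔-lub (≮⇒≥ y≮u) (≮⇒≥ y≮v)))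

-- The block containing a given element.

module _ {N r : ℕ} .{{_ : NonTrivial N}} (C : ChangePoints N r) where

  block : Fin N → Fin (suc r)
  block x = proj₁ (locate C (toℕ<n x))

  block-lower : ∀ x → lower C (block x) ≤ toℕ x
  block-lower x = proj₁ (proj₂ (locate C (toℕ<n x)))

  block-upper : ∀ x → toℕ x < upper C (block x)
  block-upper x = proj₂ (proj₂ (locate C (toℕ<n x)))

  ∈-block : ∀ x → x ∈ segment C (block x)
  ∈-block x = ∈-segment⁺ C (block-lower x) (block-upper x)

  block-unique : ∀ {i} x → lower C i ≤ toℕ x → toℕ x < upper C i → i ≡ block x
  block-unique x l u = Clustering.disjoint (clustering C) (∈-segment⁺ C l u) (∈-block x)

  -- Blocks are intervals, so an element beyond `x` is automatically above the left end of the block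
  -- of `x`; only the right end has to be tested.
  I-clustering : ∀ {x y} → toℕ x < toℕ y →
    I (clustering C) x y ≡ 𝟙 (toℕ y <? upper C (block x))
  I-clustering {x} {y} x<y = 𝟙-cong (mk⇔ to from)
    (sameCluster? (clustering C) x y) (toℕ y <? upper C (block x))
    where
    to : SameCluster (clustering C) x y → toℕ y < upper C (block x)
    -- Disjointness identifies the common cluster `a` with `block C x`.
    to (a , x∈a , y∈a) with refl ← Clustering.disjoint (clustering C) x∈a (∈-block x) =
      proj₂ (∈-segment⁻ C y∈a)

    from : toℕ y < upper C (block x) → SameCluster (clustering C) x y
    from y<u = block x , ∈-block x ,
      ∈-segment⁺ C (≤-trans (block-lower x) (<⇒≤ x<y)) y<u

-- Double counting over overlaps of blocks.

module _ {N r s : ℕ} .{{_ : NonTrivial N}} (C : ChangePoints N r) (C* : ChangePoints N s) where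

  private
    -- Two intervals meet in the interval from the larger left end to the smaller right end, so this
    -- decides whether `x` lies in both segments.
    overlap? : ∀ i j (x : Fin N) → Dec (lower C i ⊔ lower C* j ≤ toℕ x × toℕ x < upper C i ⊓ upper C* j)
    overlap? i j x = between? (lower C i ⊔ lower C* j) (upper C i ⊓ upper C* j) (toℕ x)

    d : Fin (suc r) → Fin (suc s) → ℕ
    d i j = ∣ upper C i - upper C* j ∣

    i₀ = block C
    j₀ = block C*

  sum-overlap : ∀ i j → ∑[ x < N ] 𝟙 (overlap? i j x) ≡ overlapLength C C* i j
  sum-overlap i j = sum-between (lower C i ⊔ lower C* j) (≤-trans (m⊓n≤m _ _) (upper≤N C i))

  overlap-block : ∀ {i j} x → lower C i ⊔ lower C* j ≤ toℕ x × toℕ x < upper C i ⊓ upper C* j →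
    i ≡ i₀ x × j ≡ j₀ x
  overlap-block x (l , u) =
    block-unique C  x (m⊔n≤o⇒m≤o _ _ l) (m<n⊓o⇒m<n _ _ u) ,
    block-unique C* x (m⊔n≤o⇒n≤o _ _ l) (m<n⊓o⇒m<o _ _ u)

  -- The overlaps partition the ground set, so only the pair of blocks containing `x` contributes.
  ∑∑-overlap : ∀ (g : Fin (suc r) → Fin (suc s) → ℕ) x →
    ∑[ i ≤ r ] ∑[ j ≤ s ] (𝟙 (overlap? i j x) * g i j) ≡ g (i₀ x) (j₀ x)
  ∑∑-overlap g x = begin
    ∑[ i ≤ r ] ∑[ j ≤ s ] t i j  ≡⟨ sum-single _ (i₀ x) (λ i i≢ →
      sum-zero (t i) λ j → outside (i≢ ∘ proj₁ ∘ overlap-block x)) ⟩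
    ∑[ j ≤ s ] t (i₀ x) j        ≡⟨ sum-single (t (i₀ x)) (j₀ x) (λ j j≢ →
      outside {i₀ x} {j} (j≢ ∘ proj₂ ∘ overlap-block x)) ⟩
    t (i₀ x) (j₀ x)              ≡⟨ cong (_* g (i₀ x) (j₀ x)) (𝟙-true (overlap? (i₀ x) (j₀ x) x)
      (⊔-lub (block-lower C x) (block-lower C* x) , ⊓-pres-m< (block-upper C x) (block-upper C* x))) ⟩
    1 * g (i₀ x) (j₀ x)          ≡⟨ *-identityˡ _ ⟩
    g (i₀ x) (j₀ x)              ∎
    where
    t = λ i j → 𝟙 (overlap? i j x) * g i j

    outside : ∀ {i j} → ¬ _ → t i j ≡ 0
    outside {i} {j} ∉ = cong (_* g i j) (𝟙-false (overlap? i j x) ∉)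

  -- Each overlap length is expanded into a count of its elements, and the sum over elements is then
  -- moved outermost.
  ∑∑-overlapLength : ∀ (g : Fin (suc r) → Fin (suc s) → ℕ) →
    ∑[ i ≤ r ] ∑[ j ≤ s ] (overlapLength C C* i j * g i j) ≡ ∑[ x < N ] g (i₀ x) (j₀ x)
  ∑∑-overlapLength g = begin
    ∑[ i ≤ r ] ∑[ j ≤ s ] (overlapLength C C* i j * g i j)
      ≡⟨ sum-cong-≗ (λ i → sum-cong-≗ λ j → trans
           (cong (_* g i j) (sym (sum-overlap i j)))
           (*-distribʳ-sum (g i j) λ x → 𝟙 (overlap? i j x))) ⟩
    ∑[ i ≤ r ] ∑[ j ≤ s ] ∑[ x < N ] t i j x
      ≡⟨ sum-cong-≗ (λ i → ∑-comm (t i)) ⟩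
    ∑[ i ≤ r ] ∑[ x < N ] ∑[ j ≤ s ] t i j x
      ≡⟨ ∑-comm (λ i x → ∑[ j ≤ s ] t i j x) ⟩
    ∑[ x < N ] ∑[ i ≤ r ] ∑[ j ≤ s ] t i j x
      ≡⟨ sum-cong-≗ (∑∑-overlap g) ⟩
    ∑[ x < N ] g (i₀ x) (j₀ x) ∎
    where
    t : Fin (suc r) → Fin (suc s) → Fin N → ℕ
    t i j x = 𝟙 (overlap? i j x) * g i j

  -- Counting all pairs by their smaller element.

  private
    P₁ = clustering C
    P₂ = clustering C*

    α : ℕ → Fin N → Fin N → ℕ
    α w x y = 𝟙 (agree? w (toℕ x) (toℕ y) (I P₁ x y) (I P₂ x y))

    -- Indicator of a disagreement on a pair `x < y`. The order needs no separate clause, since both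
    -- right ends exceed `x`.
    δ : Fin N → Fin N → ℕ
    δ x y = 𝟙 (between? (upper C (i₀ x) ⊓ upper C* (j₀ x)) (upper C (i₀ x) ⊔ upper C* (j₀ x)) (toℕ y))

  length-agreeing : ∀ w → length (agreeing w P₁ P₂) ≡ ∑[ x < N ] ∑[ y < N ] α w x y
  length-agreeing w = length-filter-cartesianProduct
    (λ (x , y) → agree? w (toℕ x) (toℕ y) (I P₁ x y) (I P₂ x y)) id id

  -- `I-clustering` applies only when `x < y`; the first conjunct of `agree?` supplies this in both
  -- directions.
  α-explicit : ∀ w x y → α w x y ≡ 𝟙 (agree? w (toℕ x) (toℕ y)
    (𝟙 (toℕ y <? upper C (i₀ x))) (𝟙 (toℕ y <? upper C* (j₀ x))))
  α-explicit w x y = 𝟙-cong (mk⇔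
      (λ (x<y , e , e*) → x<y , trans (sym (I-clustering C x<y)) e , trans e* (I-clustering C* x<y))
      (λ (x<y , e , e*) → x<y , trans (I-clustering C x<y) e , trans e* (sym (I-clustering C* x<y))))
    (agree? w (toℕ x) (toℕ y) (I P₁ x y) (I P₂ x y)) (agree? w (toℕ x) (toℕ y) _ _)

  α+δ : ∀ x y → α 0 x y + α 1 x y + δ x y ≡ 𝟙 (between? (suc (toℕ x)) N (toℕ y))
  α+δ x y = trans
    (cong (_+ δ x y) (cong₂ _+_ (α-explicit 0 x y) (α-explicit 1 x y)))
    (agree+disagree (block-upper C x) (block-upper C* x) (toℕ<n y))

  sum-δ : ∀ x → ∑[ y < N ] δ x y ≡ d (i₀ x) (j₀ x)
  sum-δ x = trans
    (sum-between (upper C (i₀ x) ⊓ upper C* (j₀ x)) (⊔-lub (upper≤N C (i₀ x)) (upper≤N C* (j₀ x))))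
    (⊔∸⊓≡∣-∣ (upper C (i₀ x)) (upper C* (j₀ x)))

  agreements disagreements : ℕ
  agreements    = N₀₀ P₁ P₂ + N₁₁ P₁ P₂
  disagreements = ∑[ i ≤ r ] ∑[ j ≤ s ] (overlapLength C C* i j * ∣ upper C i - upper C* j ∣)

  agreements+disagreements : agreements + disagreements ≡ N choose 2
  agreements+disagreements = begin
    agreements + disagreements
      ≡⟨ cong₂ _+_ (cong₂ _+_ (length-agreeing 0) (length-agreeing 1))
           (trans (∑∑-overlapLength d) (sym (sum-cong-≗ sum-δ))) ⟩
    ∑∑ (α 0) + ∑∑ (α 1) + ∑∑ δ
      ≡⟨ cong (_+ ∑∑ δ) (∑∑-distrib-+ (α 0) (α 1)) ⟨
    ∑∑ (λ x y → α 0 x y + α 1 x y) + ∑∑ δ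
      ≡⟨ ∑∑-distrib-+ (λ x y → α 0 x y + α 1 x y) δ ⟨
    ∑∑ (λ x y → α 0 x y + α 1 x y + δ x y)
      -- For fixed `x`, what remains is the number of `y` with `x < y < N`.
      ≡⟨ sum-cong-≗ (λ x → trans (sum-cong-≗ (α+δ x)) (sum-between (suc (toℕ x)) (≤-refl {N}))) ⟩
    ∑[ x < N ] (N ∸ suc (toℕ x))
      ≡⟨ sum-triangle N ⟩
    N choose 2 ∎
    where
    ∑∑ : (Fin N → Fin N → ℕ) → ℕ
    ∑∑ f = ∑[ x < N ] ∑[ y < N ] f x y

    ∑∑-distrib-+ : ∀ f g → ∑∑ (λ x y → f x y + g x y) ≡ ∑∑ f + ∑∑ g
    ∑∑-distrib-+ f g = trans
      (sum-cong-≗ λ x → ∑-distrib-+ (f x) (g x)) (∑-distrib-+ (sum ∘ f) (sum ∘ g))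

-- From natural numbers to rationals.

/-complement : ∀ k l {n} .{{_ : NonZero n}} → k + l ≡ n → (+ k) / n ≡ 1ℚ - (+ l) / n
-- It suffices that the two fractions add up to 1. This is checked on unnormalised rationals, where
-- equality is cross-multiplication and no reduction to lowest terms intervenes.
/-complement k l {n@(suc n-1)} k+l≡n = x≈z//y _ _ 1ℚ (ℚ.toℚᵘ-injective (begin≃
  toℚᵘ ((+ k) / n ℚ.+ (+ l) / n)          ≈⟨ ℚ.toℚᵘ-homo-+ ((+ k) / n) ((+ l) / n) ⟩
  -- With `n` in the form `suc n-1`, `(+ k) / n` is `fromℚᵘ (mkℚᵘ (+ k) n-1)` by definition.
  toℚᵘ ((+ k) / n) ℚᵘ.+ toℚᵘ ((+ l) / n)  ≈⟨ ℚᵘ.+-cong (ℚ.toℚᵘ-fromℚᵘ (mkℚᵘ (+ k) n-1))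
                                                       (ℚ.toℚᵘ-fromℚᵘ (mkℚᵘ (+ l) n-1)) ⟩
  mkℚᵘ (+ k) n-1 ℚᵘ.+ mkℚᵘ (+ l) n-1      ≈⟨ *≡* (trans (ℤ.*-identityʳ _) numerator) ⟩
  ℚᵘ.1ℚᵘ                                  ∎≃))
  where
  open import Relation.Binary.Reasoning.Setoid ℚᵘ.≃-setoid
    using (step-≈-⟩) renaming (begin_ to begin≃_; _∎ to _∎≃)

  numerator : + k ℤ.* + n ℤ.+ + l ℤ.* + n ≡ ℤ.1ℤ ℤ.* (+ n ℤ.* + n)
  numerator = begin
    + k ℤ.* + n ℤ.+ + l ℤ.* + n  ≡⟨ ℤ.*-distribʳ-+ (+ n) (+ k) (+ l) ⟨
    (+ k ℤ.+ + l) ℤ.* + n        ≡⟨ cong (λ m → + m ℤ.* + n) k+l≡n ⟩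
    + n ℤ.* + n                  ≡⟨ ℤ.*-identityˡ (+ n ℤ.* + n) ⟨
    ℤ.1ℤ ℤ.* (+ n ℤ.* + n)       ∎

theorem3p1 : (N : ℕ) .{{_ : NonTrivial N}} (r s : ℕ)
    (C : ChangePoints N r) (C* : ChangePoints N s) →
    RI (clustering C) (clustering C*)
    ≡ 1ℚ - (+ (∑[ i ≤ r ] ∑[ j ≤ s ] (overlapLength C C* i j * ∣ upper C i - upper C* j ∣))) / (N choose 2)
theorem3p1 N r s C C* =
  /-complement (agreements C C*) (disagreements C C*) (agreements+disagreements C C*)
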